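{- Let $(X,d)$ be a finite metric space and $m\ge 0$ an integer. Let $G_0,G_1,\dots,G_m$ be graphs with vertex set $X$, where $G_0$ is the complete graph on $X$ and, for each $0\le i<m$, $G_{i+1}$ is obtained from $G_i$ through a $d$-erasure. Then $G_m$ contains a minimum spanning tree of $(X,d)$.
   Context: All graphs are finite, undirected, simple; edges $xy$ are weighted by $d(xy)=d(x,y)$. A minimum spanning tree of $(X,d)$ is a spanning tree of the complete graph on $X$ minimizing the sum of the weights of its edges. A facet edge of $G$ is an edge $xy$ such that $\{x,y\}$ is a maximal clique of $G$. An edge of $G$ is exposed if it is contained in a unique maximal clique of $G$ and it is not a facet edge. For graphs $G,H$ on vertex set $X$, $H$ is obtained from $G$ through a $d$-erasure if $H=G-e$ for an exposed edge $e$ of $G$ such that $d(e)\ge d(e')$ for every exposed edge $e'$ of $G$. -}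

module Defs where

open import Level using (Level; 0ℓ; _⊔_) renaming (suc to lsuc)
open import Algebra.Core using (Op₁; Op₂)
open import Algebra.Structures using (IsAbelianGroup)
open import Data.Nat.Base using (ℕ) renaming (_+_ to _+ℕ_)
open import Data.Fin.Base using (Fin; zero; suc; inject₁; fromℕ)
open import Data.Fin.Properties using (_≟_; _<?_)
open import Data.Fin.Subset using (Subset; _∈_; _⊆_; _∪_; ⁅_⁆)
open import Data.List.Base using (List; foldr; map; filter; cartesianProduct; allFin)
open import Data.Product using (∃₂; ∃!; _×_; _,_; uncurry)
open import Data.Sum using (_⊎_; inj₁; inj₂)
open import Function.Base using (_∘_)
open import Function.Bundles using (_⇔_)
open import Function.Definitions using (Injective)
open import Function.Metric.Core using (DistanceFunction)
open import Function.Metric.Structures using (IsGeneralMetric)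
open import Relation.Binary.Core using (Rel)
open import Relation.Binary.Definitions using (Symmetric; Irreflexive; Decidable)
open import Relation.Binary.Structures using (IsTotalOrder)
open import Relation.Binary.Construct.Closure.ReflexiveTransitive using (Star)
open import Relation.Binary.PropositionalEquality using (_≡_; _≢_; sym)
open import Relation.Nullary.Negation using (¬_)
open import Relation.Nullary.Decidable using (¬?; _×-dec_; _⊎-dec_)

-- The standard library has no real numbers.  Distances take values in an
-- arbitrary totally ordered abelian group: exactly the structure of (ℝ,+,≤)
-- in which metrics and sums of edge weights are formulated.
record OrderedAbelianGroup (c ℓ₁ ℓ₂ : Level) : Set (lsuc (c ⊔ ℓ₁ ⊔ ℓ₂)) where
  infix  4 _≈_ _≤_
  infixl 6 _+_
  infix  8 -_
  field
    Carrier        : Set c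
    _≈_            : Rel Carrier ℓ₁
    _≤_            : Rel Carrier ℓ₂
    _+_            : Op₂ Carrier
    0#             : Carrier
    -_             : Op₁ Carrier
    isAbelianGroup : IsAbelianGroup _≈_ _+_ 0# -_
    isTotalOrder   : IsTotalOrder _≈_ _≤_
    +-monoˡ-≤      : ∀ z {x y} → x ≤ y → x + z ≤ y + z

record Graph (n : ℕ) : Set₁ where
  field
    Adj    : Rel (Fin n) 0ℓ
    adj?   : Decidable Adj
    symm   : Symmetric Adj
    irrefl : Irreflexive _≡_ Adj

open Graph public using (Adj; adj?)

private
  variable
    n : ℕ

infix 4 _≈ᴳ_ _⊆ᴳ_

-- Graphs are compared through their edge sets, as Adj is Set-valued.
_≈ᴳ_ : Graph n → Graph n → Set
G ≈ᴳ H = ∀ x y → Adj G x y ⇔ Adj H x y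

_⊆ᴳ_ : Graph n → Graph n → Set
G ⊆ᴳ H = ∀ {x y} → Adj G x y → Adj H x y

complete : ∀ n → Graph n
complete n = record
  { Adj    = _≢_
  ; adj?   = λ x y → ¬? (x ≟ y)
  ; symm   = λ x≢y → x≢y ∘ sym
  ; irrefl = λ x≡y x≢y → x≢y x≡y
  }

-- {a , b} ≡ {x , y} as unordered pairs
SameEdge : (a b x y : Fin n) → Set
SameEdge a b x y = (a ≡ x × b ≡ y) ⊎ (a ≡ y × b ≡ x)

deleteEdge : Graph n → (x y : Fin n) → Graph n
deleteEdge G x y = record
  { Adj    = λ a b → Adj G a b × ¬ SameEdge a b x y
  ; adj?   = λ a b → adj? G a b ×-dec
                     ¬? ((a ≟ x ×-dec b ≟ y) ⊎-dec (a ≟ y ×-dec b ≟ x))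
  ; symm   = λ (ab , ¬same) → Graph.symm G ab , ¬same ∘ swapEnds
  ; irrefl = λ a≡b (ab , _) → Graph.irrefl G a≡b ab
  }
  where
  swapEnds : ∀ {a b} → SameEdge b a x y → SameEdge a b x y
  swapEnds (inj₁ (b≡x , a≡y)) = inj₂ (a≡y , b≡x)
  swapEnds (inj₂ (b≡y , a≡x)) = inj₁ (a≡x , b≡y)

IsClique : Graph n → Subset n → Set
IsClique G C = ∀ {x y} → x ∈ C → y ∈ C → x ≢ y → Adj G x y

IsMaximalClique : Graph n → Subset n → Set
IsMaximalClique G C = IsClique G C × (∀ D → IsClique G D → C ⊆ D → D ≡ C)

IsFacetEdge : Graph n → (x y : Fin n) → Set
IsFacetEdge G x y = Adj G x y × IsMaximalClique G (⁅ x ⁆ ∪ ⁅ y ⁆)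

IsExposed : Graph n → (x y : Fin n) → Set
IsExposed G x y =
  Adj G x y ×
  ∃! _≡_ (λ C → IsMaximalClique G C × x ∈ C × y ∈ C) ×
  ¬ IsFacetEdge G x y

IsConnected : Graph n → Set
IsConnected {n} G = (x y : Fin n) → Star (Adj G) x y

-- A cycle v₀ v₁ … v₍ₖ₊₂₎ v₀ of length k + 3 with pairwise distinct vᵢ.
record Cycle (G : Graph n) : Set where
  field
    k         : ℕ
    v         : Fin (3 +ℕ k) → Fin n
    injective : Injective _≡_ _≡_ v
    step      : (i : Fin (2 +ℕ k)) → Adj G (v (inject₁ i)) (v (suc i))
    close     : Adj G (v (fromℕ (2 +ℕ k))) (v zero)

IsTree : Graph n → Set
IsTree G = IsConnected G × ¬ Cycle G

-- T is spanning because all graphs here share the vertex set Fin n.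
IsSpanningTree : Graph n → Graph n → Set
IsSpanningTree G T = T ⊆ᴳ G × IsTree T

-- Each edge is listed once, with its smaller endpoint first.
edges : Graph n → List (Fin n × Fin n)
edges {n} G =
  filter (λ (x , y) → (x <? y) ×-dec adj? G x y)
         (cartesianProduct (allFin n) (allFin n))

module _ {c ℓ₁ ℓ₂} (R : OrderedAbelianGroup c ℓ₁ ℓ₂) where
  open OrderedAbelianGroup R

  IsMetric : DistanceFunction (Fin n) Carrier → Set (c ⊔ ℓ₁ ⊔ ℓ₂)
  IsMetric = IsGeneralMetric _≡_ _≈_ _≤_ 0# _+_

  weight : DistanceFunction (Fin n) Carrier → Graph n → Carrier
  weight d G = foldr _+_ 0# (map (uncurry d) (edges G))

  IsMinimumSpanningTree : DistanceFunction (Fin n) Carrier → Graph n → Set (lsuc 0ℓ ⊔ ℓ₂)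
  IsMinimumSpanningTree {n} d T =
    IsSpanningTree (complete n) T ×
    (∀ T′ → IsSpanningTree (complete n) T′ → weight d T ≤ weight d T′)

  IsErasure : DistanceFunction (Fin n) Carrier → Graph n → Graph n → Set ℓ₂
  IsErasure d G H = ∃₂ λ x y →
    IsExposed G x y ×
    (∀ x′ y′ → IsExposed G x′ y′ → d x′ y′ ≤ d x y) ×
    H ≈ᴳ deleteEdge G x y

{-# OPTIONS --safe #-}
module Submission where

-- Along the sequence two properties persist: the graph is chordal, and it contains a minimum
-- spanning tree T.  An edge is exposed iff its endpoints have a common neighbour and their common
-- closed neighbourhood is a clique.  If T uses the erased edge e = xy, the two components of T - e
-- define a cut.  The crossing edges, two of them being near when their union is a clique, again form
-- a chordal graph, in which e is simplicial and not alone; by Dirac's theorem it has a simplicial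
-- vertex g other than e.  As both sides of the cut are connected, g lies on a cycle, hence (by
-- chordality) in a triangle, so g is exposed and not heavier than e.  Then T - e + g is a minimum
-- spanning tree avoiding e.

open import Level using (Level; 0ℓ)
open import Algebra.Bundles using (AbelianGroup)
open import Data.Bool.Base using (true; false)
open import Data.Nat.Base as ℕ using (ℕ; suc)
open import Data.Nat.Induction using (<-wellFounded; Acc; acc)
open import Data.Fin.Base using (Fin; _<_; zero; suc; inject₁; fromℕ)
open import Data.Fin.Induction using (<-weakInduction)
open import Data.Fin.Properties using (_≟_; all?; any?; fromℕ≢inject₁; suc-injective; ¬Fin0; <-cmp; <-asym)
open import Data.Fin.Subset using (Subset; ⁅_⁆; _∪_; _⊃_) renaming (_∈_ to _∈ˢ_; _⊆_ to _⊆ˢ_)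
open import Data.Fin.Subset.Properties using (x∈⁅x⁆; x∈⁅y⁆⇒x≡y; x∈p∪q⁺; x∈p∪q⁻; ⊆-antisym; p⊆p∪q) renaming (_∈?_ to _∈ˢ?_)
open import Data.Fin.Subset.Induction using (⊃-wellFounded)
open import Data.List.Base using (List; []; _∷_; length; filter; foldr; map; _++_; allFin; cartesianProduct)
import Data.List.Extrema as Extrema
open import Data.List.Properties using (filter-notAll; filter-accept; filter-reject; filter-≐)
open import Data.List.Membership.Propositional using (_∈_; lose; find)
open import Data.List.Membership.Propositional.Properties using (∈-filter⁺; ∈-filter⁻; ∈-map⁺; ∈-map⁻; ∈-++⁺ˡ; ∈-++⁺ʳ; ∈-++⁻; ∈-allFin; ∈-cartesianProduct⁺)
open import Data.List.Relation.Binary.Subset.Propositional using (_⊆_)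
open import Data.List.Relation.Unary.All as All using (All; []; _∷_)
open import Data.List.Relation.Unary.AllPairs using (_∷_)
open import Data.List.Relation.Unary.Any as Any using (Any; here; there)
open import Data.List.Relation.Unary.Unique.Propositional using (Unique)
import Data.List.Relation.Unary.Unique.Propositional.Properties as Unique
open import Data.Product using (∃; ∃₂; _×_; _,_; proj₁; proj₂; swap; uncurry)
open import Data.Product.Properties using (≡-dec)
open import Data.Sum as Sum using (_⊎_; inj₁; inj₂)
open import Data.Vec.Base using (tabulate)
open import Data.Vec.Properties using (lookup⇒[]=; []=⇒lookup; lookup∘tabulate)
open import Function.Base using (_∘_; id; case_of_)
open import Function.Bundles using (_⇔_; mk⇔; module Equivalence)
open import Function.Definitions using (Injective)
open import Function.Metric.Core using (DistanceFunction)
open import Function.Metric.Structures using (IsGeneralMetric)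
open import Relation.Binary.Bundles using (TotalOrder)
open import Relation.Binary.Core using (Rel)
open import Relation.Binary.Definitions using (Symmetric; Decidable; DecidableEquality; tri<; tri≈; tri>)
open import Relation.Binary.Structures using (IsTotalOrder)
open import Relation.Binary.Construct.Closure.ReflexiveTransitive as Star using (Star; ε; _◅_; _◅◅_)
open import Relation.Binary.PropositionalEquality using (_≡_; _≢_; refl; sym; trans; cong; subst)
open import Relation.Nullary.Decidable using (Dec; yes; no; ¬?; _×-dec_; _⊎-dec_; _→-dec_; decidable-stable; does; dec-true; dec-false; map′)
open import Relation.Nullary.Negation using (¬_; contradiction)
open import Relation.Unary using (Pred) renaming (Decidable to Decidable₁)
open import Defs

private
  variable
    n : ℕ

-- Simplicial vertices and chordality

module _ {V : Set} where

  SimplicialIn : Rel V 0ℓ → List V → V → Set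
  SimplicialIn _~_ L u = ∀ {a b} → a ∈ L → b ∈ L → u ~ a → u ~ b → a ~ b

  -- The relation is the closed neighbourhood relation (adjacent or equal); vertices not
  -- related to themselves are left out of account, so that it may be partial.
  Chordal : Rel V 0ℓ → Set
  Chordal _~_ = ∀ L → All (λ v → v ~ v) L → ∀ {v} → v ∈ L →
    ∃ λ u → u ∈ L × SimplicialIn _~_ L u

  data EliminationOrder (_~_ : Rel V 0ℓ) : List V → Set where
    []  : EliminationOrder _~_ []
    _∷_ : ∀ {h L} → SimplicialIn _~_ (h ∷ L) h → EliminationOrder _~_ L →
          EliminationOrder _~_ (h ∷ L)

  module _ {_~_ : Rel V 0ℓ} where

    -- Take a simplicial vertex, remove all its copies, and continue on the shorter list. As
    -- repetitions disappear, the result has the same elements but need not be a permutation.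
    eliminationOrder : DecidableEquality V → Chordal _~_ → ∀ L → All (λ v → v ~ v) L →
      ∃ λ L′ → EliminationOrder _~_ L′ × L ⊆ L′ × L′ ⊆ L
    eliminationOrder _≟ⱽ_ chordal L = go L (<-wellFounded (length L))
      where
      go : ∀ L → Acc ℕ._<_ (length L) → All (λ v → v ~ v) L →
        ∃ λ L′ → EliminationOrder _~_ L′ × L ⊆ L′ × L′ ⊆ L
      go [] _ _ = [] , [] , id , id
      go L@(_ ∷ _) (acc smaller) loops with chordal L loops (here refl)
      ... | u , u∈L , simplicial = extend
        (go (filter ≢u? L) (smaller (filter-notAll ≢u? L (Any.map (λ u≡v v≢u → v≢u (sym u≡v)) u∈L)))
          (All.tabulate (λ v∈ → All.lookup loops (proj₁ (∈-filter⁻ ≢u? v∈)))))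
        where
        ≢u? : ∀ v → Dec (v ≢ u)
        ≢u? v = ¬? (v ≟ⱽ u)
        extend : (∃ λ L′ → EliminationOrder _~_ L′ × filter ≢u? L ⊆ L′ × L′ ⊆ filter ≢u? L) →
          ∃ λ L′ → EliminationOrder _~_ L′ × L ⊆ L′ × L′ ⊆ L
        extend (L′ , order , ⊆L′ , L′⊆) =
          u ∷ L′ , (λ a∈ b∈ → simplicial (back a∈) (back b∈)) ∷ order , forth , back
          where
          back : u ∷ L′ ⊆ L
          back (here refl) = u∈L
          back (there v∈)  = proj₁ (∈-filter⁻ ≢u? (L′⊆ v∈))
          forth : L ⊆ u ∷ L′
          forth {v} v∈ with v ≟ⱽ u
          ... | yes v≡u = here v≡u
          ... | no  v≢u = there (⊆L′ (∈-filter⁺ ≢u? v∈ v≢u))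

    -- Adding a vertex that `g` does not see leaves the neighbourhood of `g` unchanged.
    simplicial-∷ : Symmetric _~_ → ∀ {h g L} → SimplicialIn _~_ L g → ¬ (h ~ g) →
      SimplicialIn _~_ (h ∷ L) g
    simplicial-∷ ~-sym simplicial h≁g (here refl) _           g~a _   = contradiction (~-sym g~a) h≁g
    simplicial-∷ ~-sym simplicial h≁g (there _)   (here refl) _   g~b = contradiction (~-sym g~b) h≁g
    simplicial-∷ ~-sym simplicial h≁g (there a∈)  (there b∈)  g~a g~b = simplicial a∈ b∈ g~a g~b

    -- Dirac's theorem.  When f is itself eliminated first, the simplicial vertex g found among the rest
    -- may still be near f; then the one missed by g is not, since the neighbourhood of f is a clique.
    missedSimplicial : Decidable _~_ → Symmetric _~_ → ∀ {L} → EliminationOrder _~_ L →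
      All (λ v → v ~ v) L → ∀ {f r} → f ∈ L → r ∈ L → ¬ (f ~ r) →
      ∃ λ g → g ∈ L × SimplicialIn _~_ L g × ¬ (f ~ g)
    missedSimplicial _ _ (_ ∷ _) (h~h ∷ _) (here refl) (here refl) h≁h = contradiction h~h h≁h
    missedSimplicial _~?_ ~-sym {h ∷ L} (simplicial ∷ order) (_ ∷ loops) (here refl) (there r∈) h≁r
      with Any.any? (λ p → Any.any? (λ q → ¬? (p ~? q)) L) L
    -- `L` is a clique, so `r` itself is simplicial in it.
    ... | no allNear = _ , there r∈ , simplicial-∷ ~-sym
            (λ {a} {b} a∈ b∈ _ _ → decidable-stable (a ~? b) (λ a≁b → allNear (lose a∈ (lose b∈ a≁b)))) h≁r , h≁r
    ... | yes apart with find apart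
    ... | p , p∈ , apart-p with find apart-p
    ... | q , q∈ , p≁q with missedSimplicial _~?_ ~-sym order loops p∈ q∈ p≁q
    ... | g , g∈ , g-simplicial , p≁g with h ~? g
    ... | no  h≁g = g , there g∈ , simplicial-∷ ~-sym g-simplicial h≁g , h≁g
    ... | yes h~g with missedSimplicial _~?_ ~-sym order loops g∈ p∈ (p≁g ∘ ~-sym)
    ... | k , k∈ , k-simplicial , g≁k = k , there k∈ , simplicial-∷ ~-sym k-simplicial h≁k , h≁k
      where
      h≁k : ¬ (h ~ k)
      h≁k h~k = g≁k (simplicial (there g∈) (there k∈) h~g h~k)
    missedSimplicial _~?_ ~-sym {h ∷ L} (simplicial ∷ order) (_ ∷ loops) {f} (there f∈) r∈ f≁r with h ~? f
    ... | no h≁f = h , here refl , simplicial , h≁f ∘ ~-sym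
    missedSimplicial _~?_ ~-sym (_ ∷ _) _ (there _) (here refl) f≁h | yes h~f = contradiction (~-sym h~f) f≁h
    missedSimplicial _~?_ ~-sym {h ∷ L} (simplicial ∷ order) (_ ∷ loops) {f} (there f∈) (there r∈) f≁r | yes h~f
      with missedSimplicial _~?_ ~-sym order loops f∈ r∈ f≁r
    -- If `h` saw `g`, then `f` and `g` would both lie in the clique around `h`.
    ... | g , g∈ , g-simplicial , f≁g =
      g , there g∈ , simplicial-∷ ~-sym g-simplicial (λ h~g → f≁g (simplicial (there f∈) (there g∈) h~f h~g)) , f≁g

-- Exposed edges

Near : Graph n → Rel (Fin n) 0ℓ
Near G x y = x ≡ y ⊎ Adj G x y

module _ (G : Graph n) where

  near-sym : Symmetric (Near G)
  near-sym = Sum.map sym (Graph.symm G)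

  near? : Decidable (Near G)
  near? x y = (x ≟ y) ⊎-dec adj? G x y

  near-refl : ∀ {x} → Near G x x
  near-refl = inj₁ refl

  near⇒adj : ∀ {x y} → x ≢ y → Near G x y → Adj G x y
  near⇒adj x≢y (inj₁ x≡y) = contradiction x≡y x≢y
  near⇒adj x≢y (inj₂ xy)  = xy

  adj⇒≢ : ∀ {x y} → Adj G x y → x ≢ y
  adj⇒≢ xy x≡y = Graph.irrefl G x≡y xy

  -- For an edge this amounts to lying in a unique maximal clique, without mention of subsets.
  CliqueNeighbourhood : Rel (Fin n) 0ℓ
  CliqueNeighbourhood x y = ∀ {u v} →
    Near G x u → Near G y u → Near G x v → Near G y v → Near G u v

  CommonNeighbour : Rel (Fin n) 0ℓ
  CommonNeighbour x y = ∃ λ z → Adj G x z × Adj G y z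

  clique⇒near : ∀ {C} → IsClique G C → ∀ {x y} → x ∈ˢ C → y ∈ˢ C → Near G x y
  clique⇒near clique {x} {y} x∈ y∈ with x ≟ y
  ... | yes x≡y = inj₁ x≡y
  ... | no  x≢y = inj₂ (clique x∈ y∈ x≢y)

  insert-clique : ∀ {C v} → IsClique G C → (∀ {w} → w ∈ˢ C → Near G v w) → IsClique G (C ∪ ⁅ v ⁆)
  insert-clique {C} {v} clique v~C {x} {y} x∈ y∈ x≢y with x∈p∪q⁻ C ⁅ v ⁆ x∈ | x∈p∪q⁻ C ⁅ v ⁆ y∈
  ... | inj₁ x∈C | inj₁ y∈C = clique x∈C y∈C x≢y
  ... | inj₁ x∈C | inj₂ y∈v with refl ← x∈⁅y⁆⇒x≡y v y∈v = near⇒adj x≢y (near-sym (v~C x∈C))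
  ... | inj₂ x∈v | inj₁ y∈C with refl ← x∈⁅y⁆⇒x≡y v x∈v = near⇒adj x≢y (v~C y∈C)
  ... | inj₂ x∈v | inj₂ y∈v =
    contradiction (trans (x∈⁅y⁆⇒x≡y v x∈v) (sym (x∈⁅y⁆⇒x≡y v y∈v))) x≢y

  pair-clique : ∀ {x y} → Near G x y → IsClique G (⁅ x ⁆ ∪ ⁅ y ⁆)
  pair-clique {x} {y} x~y = insert-clique
    (λ a∈ b∈ a≢b → contradiction (trans (x∈⁅y⁆⇒x≡y x a∈) (sym (x∈⁅y⁆⇒x≡y x b∈))) a≢b)
    (λ w∈ → subst (Near G y) (sym (x∈⁅y⁆⇒x≡y x w∈)) (near-sym x~y))

  -- A vertex near the whole clique is added as long as there is one; subsets of `Fin n` cannot grow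
  -- forever.
  extendToMaximal : ∀ C → IsClique G C → ∃ λ D → IsMaximalClique G D × C ⊆ˢ D
  extendToMaximal C = go C (⊃-wellFounded C)
    where
    go : ∀ C → Acc _⊃_ C → IsClique G C → ∃ λ D → IsMaximalClique G D × C ⊆ˢ D
    go C (acc larger) clique
      with any? (λ v → ¬? (v ∈ˢ? C) ×-dec all? (λ w → (w ∈ˢ? C) →-dec near? v w))
    ... | no none = C , ((λ {x} {y} → clique {x} {y}) , maximal) , id
      where
      maximal : ∀ D → IsClique G D → C ⊆ˢ D → D ≡ C
      maximal D D-clique C⊆D = ⊆-antisym
        (λ {v} v∈D → decidable-stable (v ∈ˢ? C) λ v∉C →
          none (v , v∉C , λ w w∈C → clique⇒near D-clique v∈D (C⊆D w∈C)))
        C⊆D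
    ... | yes (v , v∉C , v~C)
      with go (C ∪ ⁅ v ⁆) (larger (p⊆p∪q ⁅ v ⁆ , v , x∈p∪q⁺ (inj₂ (x∈⁅x⁆ v)) , v∉C))
              (insert-clique clique (v~C _))
    ... | D , D-maximal , C∪v⊆D = D , D-maximal , C∪v⊆D ∘ p⊆p∪q ⁅ v ⁆

  -- A vertex `w` near both ends forms a clique with them. By uniqueness a maximal clique extending
  -- it is `C`, so the whole common closed neighbourhood lies in `C`.
  exposed⇒cliqueNeighbourhood : ∀ {x y} → IsExposed G x y → CliqueNeighbourhood x y
  exposed⇒cliqueNeighbourhood {x} {y} (xy , (C , (C-maximal , _) , unique) , _) {u} {v} xu yu xv yv =
    clique⇒near (proj₁ C-maximal) (inC xu yu) (inC xv yv)
    where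
    inC : ∀ {w} → Near G x w → Near G y w → w ∈ˢ C
    inC {w} xw yw with extendToMaximal ((⁅ x ⁆ ∪ ⁅ y ⁆) ∪ ⁅ w ⁆)
                         (insert-clique (pair-clique (inj₂ xy)) nearPair)
      where
      nearPair : ∀ {z} → z ∈ˢ (⁅ x ⁆ ∪ ⁅ y ⁆) → Near G w z
      nearPair z∈ with x∈p∪q⁻ ⁅ x ⁆ ⁅ y ⁆ z∈
      ... | inj₁ z∈x with refl ← x∈⁅y⁆⇒x≡y x z∈x = near-sym xw
      ... | inj₂ z∈y with refl ← x∈⁅y⁆⇒x≡y y z∈y = near-sym yw
    ... | D , D-maximal , ⊆D = subst (w ∈ˢ_) (sym C≡D) (⊆D (x∈p∪q⁺ (inj₂ (x∈⁅x⁆ w))))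
      where
      C≡D : C ≡ D
      C≡D = unique (D-maximal , ⊆D (x∈p∪q⁺ (inj₁ (x∈p∪q⁺ (inj₁ (x∈⁅x⁆ x)))))
                              , ⊆D (x∈p∪q⁺ (inj₁ (x∈p∪q⁺ (inj₂ (x∈⁅x⁆ y))))))

  -- Without a third vertex, `C` would be the pair itself and the edge a facet edge.
  exposed⇒commonNeighbour : ∀ {x y} → IsExposed G x y → CommonNeighbour x y
  exposed⇒commonNeighbour {x} {y} (xy , (C , (C-maximal , x∈C , y∈C) , _) , ¬facet)
    with any? (λ z → (z ∈ˢ? C) ×-dec (¬? (x ≟ z) ×-dec ¬? (y ≟ z)))
  ... | yes (z , z∈C , x≢z , y≢z) = z , proj₁ C-maximal x∈C z∈C x≢z , proj₁ C-maximal y∈C z∈C y≢z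
  ... | no none = contradiction (xy , subst (IsMaximalClique G) C≡xy C-maximal) ¬facet
    where
    C⊆xy : C ⊆ˢ ⁅ x ⁆ ∪ ⁅ y ⁆
    C⊆xy {z} z∈C with x ≟ z | y ≟ z
    ... | yes refl | _        = x∈p∪q⁺ (inj₁ (x∈⁅x⁆ x))
    ... | no _     | yes refl = x∈p∪q⁺ (inj₂ (x∈⁅x⁆ y))
    ... | no x≢z   | no y≢z   = contradiction (z , z∈C , x≢z , y≢z) none
    C≡xy : C ≡ ⁅ x ⁆ ∪ ⁅ y ⁆
    C≡xy = sym (proj₂ C-maximal _ (pair-clique (inj₂ xy)) C⊆xy)

  -- The common closed neighbourhood `C` is a clique containing every clique through `x` and `y`, so
  -- it is the only maximal one; as it contains `z`, it is larger than the pair.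
  cliqueNeighbourhood⇒exposed : ∀ {x y} → Adj G x y → CliqueNeighbourhood x y → CommonNeighbour x y →
    IsExposed G x y
  cliqueNeighbourhood⇒exposed {x} {y} xy near-clique (z , xz , yz) =
    xy , (C , ((C-clique , C-maximal) , x∈C , y∈C) , unique) , ¬facet
    where
    inC? : ∀ w → Dec (Near G x w × Near G y w)
    inC? w = near? x w ×-dec near? y w
    C : Subset _
    C = tabulate (does ∘ inC?)
    ∈C⁺ : ∀ {w} → Near G x w × Near G y w → w ∈ˢ C
    ∈C⁺ {w} near = lookup⇒[]= w C (trans (lookup∘tabulate _ w) (dec-true (inC? w) near))
    ∈C⁻ : ∀ {w} → w ∈ˢ C → Near G x w × Near G y w
    ∈C⁻ {w} w∈C = decidable-stable (inC? w) λ ¬near →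
      contradiction (trans (sym (dec-false (inC? w) ¬near)) (trans (sym (lookup∘tabulate _ w)) ([]=⇒lookup w∈C))) λ ()
    x∈C : x ∈ˢ C
    x∈C = ∈C⁺ (near-refl , inj₂ (Graph.symm G xy))
    y∈C : y ∈ˢ C
    y∈C = ∈C⁺ (inj₂ xy , near-refl)
    C-clique : IsClique G C
    C-clique u∈ v∈ u≢v = near⇒adj u≢v
      (near-clique (proj₁ (∈C⁻ u∈)) (proj₂ (∈C⁻ u∈)) (proj₁ (∈C⁻ v∈)) (proj₂ (∈C⁻ v∈)))
    ⊆C : ∀ {D} → IsClique G D → x ∈ˢ D → y ∈ˢ D → D ⊆ˢ C
    ⊆C D-clique x∈D y∈D w∈D = ∈C⁺ (clique⇒near D-clique x∈D w∈D , clique⇒near D-clique y∈D w∈D)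
    C-maximal : ∀ D → IsClique G D → C ⊆ˢ D → D ≡ C
    C-maximal D D-clique C⊆D = ⊆-antisym (⊆C D-clique (C⊆D x∈C) (C⊆D y∈C)) C⊆D
    unique : ∀ {D} → IsMaximalClique G D × x ∈ˢ D × y ∈ˢ D → C ≡ D
    unique ((D-clique , D-maximal) , x∈D , y∈D) = D-maximal C C-clique (⊆C D-clique x∈D y∈D)
    ¬facet : ¬ IsFacetEdge G x y
    ¬facet (_ , _ , xy-maximal)
      with x∈p∪q⁻ ⁅ x ⁆ ⁅ y ⁆ (subst (z ∈ˢ_) (xy-maximal C C-clique xy⊆C) (∈C⁺ (inj₂ xz , inj₂ yz)))
      where
      xy⊆C : ⁅ x ⁆ ∪ ⁅ y ⁆ ⊆ˢ C
      xy⊆C w∈ with x∈p∪q⁻ ⁅ x ⁆ ⁅ y ⁆ w∈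
      ... | inj₁ w∈x with refl ← x∈⁅y⁆⇒x≡y x w∈x = x∈C
      ... | inj₂ w∈y with refl ← x∈⁅y⁆⇒x≡y y w∈y = y∈C
    ... | inj₁ z∈x = adj⇒≢ xz (sym (x∈⁅y⁆⇒x≡y x z∈x))
    ... | inj₂ z∈y = adj⇒≢ yz (sym (x∈⁅y⁆⇒x≡y y z∈y))

-- Deleting edges of chordal graphs

SameEdge? : ∀ (a b x y : Fin n) → Dec (SameEdge a b x y)
SameEdge? a b x y = ((a ≟ x) ×-dec (b ≟ y)) ⊎-dec ((a ≟ y) ×-dec (b ≟ x))

sameEdge-sym : ∀ {a b x y : Fin n} → SameEdge a b x y → SameEdge x y a b
sameEdge-sym (inj₁ (refl , refl)) = inj₁ (refl , refl)
sameEdge-sym (inj₂ (refl , refl)) = inj₂ (refl , refl)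

sameEdge-trans : ∀ {a b p q x y : Fin n} → SameEdge a b p q → SameEdge p q x y → SameEdge a b x y
sameEdge-trans (inj₁ (refl , refl)) same = same
sameEdge-trans (inj₂ (refl , refl)) (inj₁ (refl , refl)) = inj₂ (refl , refl)
sameEdge-trans (inj₂ (refl , refl)) (inj₂ (refl , refl)) = inj₁ (refl , refl)

-- A simplicial vertex h near both x and y stops being simplicial once xy is deleted.  Its closed
-- neighbourhood lies in the unique maximal clique on xy, so dropping it and
-- searching on among the remaining vertices loses nothing.
chordal-deleteEdge : ∀ {G H : Graph n} {x y} → Chordal (Near G) → CliqueNeighbourhood G x y →
  H ≈ᴳ deleteEdge G x y → Chordal (Near H)
chordal-deleteEdge {n} {G} {H} {x} {y} chordal near-clique H≈G-xy L _ v∈L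
  with eliminationOrder _≟_ chordal L (All.tabulate λ _ → near-refl G)
... | L′ , order , L⊆L′ , L′⊆L = conclude (Any.any? (x ≟_) L′) (Any.any? (y ≟_) L′)
  where
  -- A simplicial vertex of this kind survives the deletion of `xy`: either it does not see both
  -- ends, or it is one of them, and then seeing the other is already the nearness required.
  Avoids : Fin n → Set
  Avoids u = ¬ (Near G x u × Near G y u) ⊎ u ≡ x ⊎ u ≡ y

  avoiding : ∀ {L} → EliminationOrder (Near G) L → x ∈ L → y ∈ L →
    ∃ λ u → u ∈ L × SimplicialIn (Near G) L u × Avoids u
  avoiding {h ∷ L} (simplicial ∷ order) x∈ y∈
    with (near? G x h ×-dec near? G y h) | h ≟ x | h ≟ y
  ... | no ¬common | _ | _ = h , here refl , simplicial , inj₁ ¬common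
  ... | yes _ | yes h≡x | _ = h , here refl , simplicial , inj₂ (inj₁ h≡x)
  ... | yes _ | no _ | yes h≡y = h , here refl , simplicial , inj₂ (inj₂ h≡y)
  ... | yes (xh , yh) | no h≢x | no h≢y
    with avoiding order (Any.tail (h≢x ∘ sym) x∈) (Any.tail (h≢y ∘ sym) y∈)
  ... | u , u∈ , u-simplicial , inj₁ ¬common = u , there u∈ , simplicial-∷ (near-sym G) u-simplicial h≁u , inj₁ ¬common
    where
    -- If `h` saw `u`, the clique around `h` would contain `x`, `y` and `u`, so `u` would be near
    -- both ends.
    h≁u : ¬ Near G h u
    h≁u hu = ¬common (simplicial x∈ (there u∈) (near-sym G xh) hu , simplicial y∈ (there u∈) (near-sym G yh) hu)
  -- Within `L` the vertex `x` is simplicial and sees `y`, so whatever it sees is near `y` as well;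
  -- `near-clique` then gives simpliciality in `h ∷ L`.
  ... | u , u∈ , u-simplicial , inj₂ (inj₁ refl) =
    u , there u∈ , (λ a∈ b∈ xa xb → near-clique xa (nearY a∈ xa) xb (nearY b∈ xb)) , inj₂ (inj₁ refl)
    where
    xy : Near G x y
    xy = simplicial x∈ y∈ (near-sym G xh) (near-sym G yh)
    nearY : ∀ {a} → a ∈ h ∷ L → Near G x a → Near G y a
    nearY (here refl) _  = yh
    nearY (there a∈)  xa = u-simplicial (Any.tail (h≢y ∘ sym) y∈) a∈ xy xa
  ... | u , u∈ , u-simplicial , inj₂ (inj₂ refl) =
    u , there u∈ , (λ a∈ b∈ ya yb → near-clique (nearX a∈ ya) ya (nearX b∈ yb) yb) , inj₂ (inj₂ refl)
    where
    yx : Near G y x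
    yx = simplicial y∈ x∈ (near-sym G yh) (near-sym G xh)
    nearX : ∀ {a} → a ∈ h ∷ L → Near G y a → Near G x a
    nearX (here refl) _  = xh
    nearX (there a∈)  ya = u-simplicial (Any.tail (h≢x ∘ sym) x∈) a∈ yx ya

  H⇒G : ∀ {a b} → Near H a b → Near G a b
  H⇒G (inj₁ a≡b) = inj₁ a≡b
  H⇒G (inj₂ ab)  = inj₂ (proj₁ (Equivalence.to (H≈G-xy _ _) ab))

  Result : Set
  Result = ∃ λ u → u ∈ L × SimplicialIn (Near H) L u

  transfer : ∀ {u} → u ∈ L′ → SimplicialIn (Near G) L′ u →
    (x ∈ L′ → y ∈ L′ → Near H u x → Near H u y → Near H x y) → Result
  transfer {u} u∈ simplicial xy-near = u , L′⊆L u∈ , simplicial-H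
    where
    simplicial-H : SimplicialIn (Near H) L u
    simplicial-H {a} {b} a∈ b∈ ua ub
      with simplicial (L⊆L′ a∈) (L⊆L′ b∈) (H⇒G ua) (H⇒G ub)
    ... | inj₁ a≡b = inj₁ a≡b
    ... | inj₂ ab with SameEdge? a b x y
    ... | no  ¬same = inj₂ (Equivalence.from (H≈G-xy a b) (ab , ¬same))
    ... | yes (inj₁ (refl , refl)) = xy-near (L⊆L′ a∈) (L⊆L′ b∈) ua ub
    ... | yes (inj₂ (refl , refl)) = near-sym H (xy-near (L⊆L′ b∈) (L⊆L′ a∈) ub ua)

  first : ∀ {L v} → EliminationOrder (Near G) L → v ∈ L → ∃ λ u → u ∈ L × SimplicialIn (Near G) L u
  first (simplicial ∷ _) _ = _ , here refl , simplicial

  conclude : Dec (x ∈ L′) → Dec (y ∈ L′) → Result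
  conclude (yes x∈) (yes y∈) with avoiding order x∈ y∈
  ... | u , u∈ , simplicial , inj₁ ¬common = transfer u∈ simplicial
    λ _ _ ux uy → contradiction (near-sym G (H⇒G ux) , near-sym G (H⇒G uy)) ¬common
  ... | u , u∈ , simplicial , inj₂ (inj₁ refl) = transfer u∈ simplicial λ _ _ _ xy → xy
  ... | u , u∈ , simplicial , inj₂ (inj₂ refl) = transfer u∈ simplicial λ _ _ yx _ → near-sym H yx
  -- The deleted edge does not join two vertices of the list, so any simplicial vertex will do.
  conclude (no x∉) _ with first order (L⊆L′ v∈L)
  ... | u , u∈ , simplicial = transfer u∈ simplicial λ x∈ → contradiction x∈ x∉
  conclude (yes _) (no y∉) with first order (L⊆L′ v∈L)
  ... | u , u∈ , simplicial = transfer u∈ simplicial λ _ y∈ → contradiction y∈ y∉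

-- Shortcutting a walk at the simplicial vertices, in elimination order, ends in a triangle on a b.
detour⇒commonNeighbour : ∀ {G : Graph n} {a b} → Chordal (Near G) → Adj G a b →
  Star (Adj (deleteEdge G a b)) a b → CommonNeighbour G a b
detour⇒commonNeighbour {n} {G} {a} {b} chordal ab walk
  with eliminationOrder _≟_ chordal (allFin n) (All.tabulate λ _ → near-refl G)
... | L₀ , order₀ , allFin⊆L₀ , _ = go order₀ (allFin⊆L₀ (∈-allFin b))
    (Star.map (λ uv → (allFin⊆L₀ (∈-allFin _) , allFin⊆L₀ (∈-allFin _)) , uv) walk)
  where
  Within : List (Fin n) → Rel (Fin n) 0ℓ
  Within L u v = (u ∈ L × v ∈ L) × Adj (deleteEdge G a b) u v

  module _ {h L} (simplicial : SimplicialIn (Near G) (h ∷ L) h) (h≢b : h ≢ b) where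

    -- A passage from `p` over `h` to `q` is bypassed by the chord `pq`, which exists as `h` is
    -- simplicial, or dropped if `p` and `q` coincide. If the chord is `ab` itself, `h` is the
    -- common neighbour sought.
    shortcut : ∀ {p} → p ≢ h → Star (Within (h ∷ L)) p b → Star (Within L) p b ⊎ CommonNeighbour G a b
    shortcut p≢h ε = inj₁ ε
    shortcut p≢h (_◅_ {j = r} ((p∈ , r∈) , pr) rest) with r ≟ h
    ... | no r≢h = Sum.map₁ (((Any.tail p≢h p∈ , Any.tail r≢h r∈) , pr) ◅_) (shortcut r≢h rest)
    shortcut p≢h (_ ◅ ε) | yes r≡h = contradiction (sym r≡h) h≢b
    shortcut {p} p≢h (((p∈ , _) , (ph , _)) ◅ (_◅_ {j = q} ((_ , q∈) , (hq , _)) rest)) | yes refl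
      with simplicial p∈ q∈ (near-sym G (inj₂ ph)) (inj₂ hq)
    ... | inj₁ refl = shortcut p≢h rest
    ... | inj₂ pq with SameEdge? p q a b
    ... | yes (inj₁ (refl , refl)) = inj₂ (h , ph , Graph.symm G hq)
    ... | yes (inj₂ (refl , refl)) = inj₂ (h , Graph.symm G hq , ph)
    ... | no ¬same = Sum.map₁ (((Any.tail p≢h p∈ , Any.tail q≢h q∈) , (pq , ¬same)) ◅_) (shortcut q≢h rest)
      where
      q≢h : q ≢ h
      q≢h = adj⇒≢ G hq ∘ sym

  within-sym : ∀ {L} → Symmetric (Within L)
  within-sym (uv∈ , uv) = swap uv∈ , Graph.symm (deleteEdge G a b) uv

  go : ∀ {L} → EliminationOrder (Near G) L → b ∈ L → Star (Within L) a b → CommonNeighbour G a b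
  go _ _ ε = contradiction refl (adj⇒≢ G ab)
  go [] () (_ ◅ _)
  go (_∷_ {h} simplicial order) b∈ walk@(((a∈ , r∈) , (ar , ¬same)) ◅ _) with h ≟ a | h ≟ b
  -- When an end of `ab` is eliminated, it sees both the other end and the next vertex of the walk,
  -- so these two are adjacent.
  ... | yes refl | _ =
    _ , ar , near⇒adj G (λ b≡r → ¬same (inj₁ (refl , sym b≡r))) (simplicial b∈ r∈ (inj₂ ab) (inj₂ ar))
  ... | no h≢a | no h≢b with shortcut simplicial h≢b (h≢a ∘ sym) walk
  ... | inj₁ shorter = go order (Any.tail (h≢b ∘ sym) b∈) shorter
  ... | inj₂ common  = common
  go (simplicial ∷ _) b∈ walk@(((a∈ , _) , _) ◅ _) | no h≢a | yes refl with Star.reverse within-sym walk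
  ... | ε = contradiction refl h≢a
  ... | ((_ , r∈) , (br , ¬same)) ◅ _ =
    _ , near⇒adj G (λ a≡r → ¬same (inj₂ (refl , sym a≡r)))
          (simplicial a∈ r∈ (inj₂ (Graph.symm G ab)) (inj₂ br)) , br

-- Deciding reachability

-- The extra edge is needed at most once: two passages in opposite directions cancel, and of two in
-- the same direction one suffices.
star-insert : ∀ {R S : Rel (Fin n) 0ℓ} {a b} → (∀ {u v} → S u v → R u v ⊎ SameEdge u v a b) →
  ∀ {u v} → Star S u v → Star R u v ⊎ (Star R u a × Star R b v) ⊎ (Star R u b × Star R a v)
star-insert S⊆ ε = inj₁ ε
star-insert S⊆ (s ◅ rest) with S⊆ s | star-insert S⊆ rest
... | inj₁ r | inj₁ p              = inj₁ (r ◅ p)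
... | inj₁ r | inj₂ (inj₁ (p , q)) = inj₂ (inj₁ (r ◅ p , q))
... | inj₁ r | inj₂ (inj₂ (p , q)) = inj₂ (inj₂ (r ◅ p , q))
... | inj₂ (inj₁ (refl , refl)) | inj₁ p              = inj₂ (inj₁ (ε , p))
... | inj₂ (inj₁ (refl , refl)) | inj₂ (inj₁ (_ , q)) = inj₂ (inj₁ (ε , q))
... | inj₂ (inj₁ (refl , refl)) | inj₂ (inj₂ (_ , q)) = inj₁ q
... | inj₂ (inj₂ (refl , refl)) | inj₁ p              = inj₂ (inj₂ (ε , p))
... | inj₂ (inj₂ (refl , refl)) | inj₂ (inj₁ (_ , q)) = inj₁ q
... | inj₂ (inj₂ (refl , refl)) | inj₂ (inj₂ (_ , q)) = inj₂ (inj₂ (ε , q))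

Listed : List (Fin n × Fin n) → Rel (Fin n) 0ℓ
Listed L u v = Any (λ (a , b) → SameEdge u v a b) L

-- Induction on the edges: `star-insert` reduces reachability with an edge to reachability without
-- it.
star-listed? : ∀ (L : List (Fin n × Fin n)) → Decidable (Star (Listed L))
star-listed? [] u v = map′ (λ { refl → ε }) (λ { ε → refl ; (() ◅ _) }) (u ≟ v)
star-listed? ((a , b) ∷ L) u v = map′ join (star-insert λ { (here same) → inj₂ same ; (there uv) → inj₁ uv })
  (star-listed? L u v ⊎-dec
    ((star-listed? L u a ×-dec star-listed? L b v) ⊎-dec (star-listed? L u b ×-dec star-listed? L a v)))
  where
  lift : ∀ {p q} → Star (Listed L) p q → Star (Listed ((a , b) ∷ L)) p q
  lift = Star.map there
  join : Star (Listed L) u v ⊎ (Star (Listed L) u a × Star (Listed L) b v) ⊎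
         (Star (Listed L) u b × Star (Listed L) a v) → Star (Listed ((a , b) ∷ L)) u v
  join (inj₁ p)              = lift p
  join (inj₂ (inj₁ (p , q))) = lift p ◅◅ here (inj₁ (refl , refl)) ◅ lift q
  join (inj₂ (inj₂ (p , q))) = lift p ◅◅ here (inj₂ (refl , refl)) ◅ lift q

allPairs : ∀ n → List (Fin n × Fin n)
allPairs n = cartesianProduct (allFin n) (allFin n)

∈-allPairs : ∀ (p : Fin n × Fin n) → p ∈ allPairs n
∈-allPairs (a , b) = ∈-cartesianProduct⁺ (∈-allFin a) (∈-allFin b)

adjPairs : Graph n → List (Fin n × Fin n)
adjPairs {n} G = filter (λ (a , b) → adj? G a b) (allPairs n)

listed⁺ : ∀ (G : Graph n) {u v} → Adj G u v → Listed (adjPairs G) u v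
listed⁺ G uv = lose (∈-filter⁺ (λ (a , b) → adj? G a b) (∈-allPairs _) uv) (inj₁ (refl , refl))

listed⁻ : ∀ (G : Graph n) {u v} → Listed (adjPairs G) u v → Adj G u v
listed⁻ G uv with find uv
... | _ , ab∈ , inj₁ (refl , refl) = proj₂ (∈-filter⁻ (λ (a , b) → adj? G a b) {xs = allPairs _} ab∈)
... | _ , ab∈ , inj₂ (refl , refl) = Graph.symm G (proj₂ (∈-filter⁻ (λ (a , b) → adj? G a b) {xs = allPairs _} ab∈))

connected? : ∀ (G : Graph n) → Decidable (Star (Adj G))
connected? G u v = map′ (Star.map (listed⁻ G)) (Star.map (listed⁺ G)) (star-listed? (adjPairs G) u v)

connected-sym : ∀ (G : Graph n) → Symmetric (Star (Adj G))
connected-sym G = Star.reverse (Graph.symm G)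

-- Exposed edges across a cut

-- Two edges are near when their union is a clique; an edge lies in a unique maximal clique iff it is
-- simplicial for this relation.
EdgeNear : Graph n → Rel (Fin n × Fin n) 0ℓ
EdgeNear G (a , b) (p , q) = (Near G a p × Near G a q) × (Near G b p × Near G b q)

-- Take a vertex `u` simplicial among the ends of the listed edges, and an edge `e` with end `u`.
-- Edges near `e` have both ends near `u`, hence all these ends are near each other.
edgeNear-chordal : ∀ {G : Graph n} → Chordal (Near G) → Chordal (EdgeNear G)
edgeNear-chordal {n} {G} chordal L _ {v} v∈L = result
  (chordal ends (All.tabulate λ _ → near-refl G) (∈-++⁺ˡ (∈-map⁺ proj₁ v∈L)))
  where
  ends : List (Fin n)
  ends = map proj₁ L ++ map proj₂ L
  fst∈ : ∀ {a b} → (a , b) ∈ L → a ∈ ends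
  fst∈ e∈ = ∈-++⁺ˡ (∈-map⁺ proj₁ e∈)
  snd∈ : ∀ {a b} → (a , b) ∈ L → b ∈ ends
  snd∈ e∈ = ∈-++⁺ʳ (map proj₁ L) (∈-map⁺ proj₂ e∈)

  near : ∀ {u} → SimplicialIn (Near G) ends u → ∀ {e f} → e ∈ L → f ∈ L →
    Near G u (proj₁ e) × Near G u (proj₂ e) → Near G u (proj₁ f) × Near G u (proj₂ f) → EdgeNear G e f
  near simplicial e∈ f∈ (ua , ub) (up , uq) =
    (simplicial (fst∈ e∈) (fst∈ f∈) ua up , simplicial (fst∈ e∈) (snd∈ f∈) ua uq) ,
    (simplicial (snd∈ e∈) (fst∈ f∈) ub up , simplicial (snd∈ e∈) (snd∈ f∈) ub uq)

  result : (∃ λ u → u ∈ ends × SimplicialIn (Near G) ends u) →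
    ∃ λ e → e ∈ L × SimplicialIn (EdgeNear G) L e
  result (u , u∈ , simplicial) with ∈-++⁻ (map proj₁ L) u∈
  ... | inj₁ u∈₁ with ∈-map⁻ proj₁ u∈₁
  ... | e , e∈ , refl = e , e∈ , λ a∈ b∈ ea eb → near simplicial a∈ b∈ (proj₁ ea) (proj₁ eb)
  result (u , u∈ , simplicial) | inj₂ u∈₂ with ∈-map⁻ proj₂ u∈₂
  ... | e , e∈ , refl = e , e∈ , λ a∈ b∈ ea eb → near simplicial a∈ b∈ (proj₂ ea) (proj₂ eb)

-- In the application `F` is the tree without its edge `xy`; the components of `x` and `y` in `F`
-- are the sides of the cut.
anotherExposed : ∀ {G F : Graph n} {x y} → Chordal (Near G) → F ⊆ᴳ G → IsExposed G x y →
  ¬ Star (Adj F) x y → (∀ v → Star (Adj F) x v ⊎ Star (Adj F) y v) →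
  ∃₂ λ a b → Star (Adj F) x a × Star (Adj F) y b × IsExposed G a b × ¬ SameEdge a b x y
anotherExposed {n} {G} {F} {x} {y} chordal F⊆G exposed x≁y cover = conclude
  where
  -- Crossing edges are oriented from the side of `x` to that of `y`, so each is represented by one
  -- pair only.
  Crossing : Fin n × Fin n → Set
  Crossing (a , b) = Star (Adj F) x a × Star (Adj F) y b × Adj G a b

  crossing? : ∀ e → Dec (Crossing e)
  crossing? (a , b) = connected? F x a ×-dec (connected? F y b ×-dec adj? G a b)

  cut : List (Fin n × Fin n)
  cut = filter crossing? (allPairs n)

  cut⁺ : ∀ {e} → Crossing e → e ∈ cut
  cut⁺ = ∈-filter⁺ crossing? (∈-allPairs _)

  cut⁻ : ∀ {e} → e ∈ cut → Crossing e
  cut⁻ e∈ = proj₂ (∈-filter⁻ crossing? {xs = allPairs n} e∈)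

  separated : ∀ {a b} → Star (Adj F) x a → Star (Adj F) y b → ¬ Star (Adj F) a b
  separated xa yb ab = x≁y (xa ◅◅ ab ◅◅ connected-sym F yb)

  separated-≢ : ∀ {a b} → Star (Adj F) x a → Star (Adj F) y b → a ≢ b
  separated-≢ xa yb refl = separated xa yb ε

  xy∈cut : (x , y) ∈ cut
  xy∈cut = cut⁺ (ε , ε , proj₁ exposed)

  edgeNear-sym : Symmetric (EdgeNear G)
  edgeNear-sym ((ap , aq) , (bp , bq)) =
    (near-sym G ap , near-sym G bp) , (near-sym G aq , near-sym G bq)

  edgeNear? : Decidable (EdgeNear G)
  edgeNear? (a , b) (p , q) = (near? G a p ×-dec near? G a q) ×-dec (near? G b p ×-dec near? G b q)

  adj⇒loop : ∀ {a b} → Adj G a b → EdgeNear G (a , b) (a , b)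
  adj⇒loop ab = (near-refl G , inj₂ ab) , (inj₂ (Graph.symm G ab) , near-refl G)

  xy-simplicial : ∀ {e f} → EdgeNear G (x , y) e → EdgeNear G (x , y) f → EdgeNear G e f
  xy-simplicial ((xa , xb) , (ya , yb)) ((xp , xq) , (yp , yq)) =
    (near xa ya xp yp , near xa ya xq yq) , (near xb yb xp yp , near xb yb xq yq)
    where
    near : CliqueNeighbourhood G x y
    near = exposed⇒cliqueNeighbourhood G exposed

  -- A common neighbour of `x` and `y` lies on one side and is joined to the end on the other.
  anotherCrossing : ∃ λ e → e ∈ cut × e ≢ (x , y)
  anotherCrossing with exposed⇒commonNeighbour G exposed
  ... | z , xz , yz with cover z
  ... | inj₁ x⇝z = (z , y) , cut⁺ (x⇝z , ε , Graph.symm G yz) , λ { refl → adj⇒≢ G xz refl }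
  ... | inj₂ y⇝z = (x , z) , cut⁺ (ε , y⇝z , xz) , λ { refl → adj⇒≢ G yz refl }

  anotherSimplicial : ∃ λ e → e ∈ cut × e ≢ (x , y) × SimplicialIn (EdgeNear G) cut e
  anotherSimplicial with Any.any? (λ r → ¬? (edgeNear? (x , y) r)) cut
  -- All crossing edges lie in the clique around `xy`, so any other one is simplicial.
  ... | no allNear with anotherCrossing
  ... | e , e∈ , e≢xy = e , e∈ , e≢xy , λ a∈ b∈ _ _ → xy-simplicial (near a∈) (near b∈)
    where
    near : ∀ {f} → f ∈ cut → EdgeNear G (x , y) f
    near {f} f∈ = decidable-stable (edgeNear? (x , y) f) λ ¬near → allNear (lose f∈ ¬near)
  anotherSimplicial | yes far with find far
                      | eliminationOrder (≡-dec _≟_ _≟_) (edgeNear-chordal {G = G} chordal) cut loops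
    where
    loops : All (λ e → EdgeNear G e e) cut
    loops = All.tabulate λ e∈ → adj⇒loop (proj₂ (proj₂ (cut⁻ e∈)))
  -- Dirac's theorem yields a simplicial crossing edge not near `xy`, in particular different from
  -- it.
  ... | r , r∈ , xy≁r | L , order , cut⊆L , L⊆cut
    with missedSimplicial edgeNear? edgeNear-sym order
           (All.tabulate λ e∈ → adj⇒loop (proj₂ (proj₂ (cut⁻ (L⊆cut e∈))))) (cut⊆L xy∈cut) (cut⊆L r∈) xy≁r
  ... | e , e∈ , simplicial , xy≁e = e , L⊆cut e∈ , (λ { refl → xy≁e (adj⇒loop (proj₁ exposed)) })
        , λ a∈ b∈ → simplicial (cut⊆L a∈) (cut⊆L b∈)

  conclude : ∃₂ λ a b → Star (Adj F) x a × Star (Adj F) y b × IsExposed G a b × ¬ SameEdge a b x y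
  conclude with anotherSimplicial
  ... | (a , b) , e∈ , e≢xy , simplicial with cut⁻ e∈
  ... | xa , yb , ab = a , b , xa , yb ,
      cliqueNeighbourhood⇒exposed G ab near (detour⇒commonNeighbour {G = G} chordal ab detour) , ¬same
    where
    ¬same : ¬ SameEdge a b x y
    ¬same (inj₁ (refl , refl)) = e≢xy refl
    ¬same (inj₂ (refl , refl)) = x≁y xa

    F⊆G-ab : F ⊆ᴳ deleteEdge G a b
    F⊆G-ab uv = F⊆G uv , λ where
      (inj₁ (refl , refl)) → separated xa yb (uv ◅ ε)
      (inj₂ (refl , refl)) → separated xa yb (Graph.symm F uv ◅ ε)

    -- From `a` to `x` inside `F`, across `xy`, and from `y` to `b` inside `F`. The edge `ab` is
    -- avoided because it is neither `xy` nor an edge of `F`.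
    detour : Star (Adj (deleteEdge G a b)) a b
    detour = Star.map F⊆G-ab (connected-sym F xa)
      ◅◅ (proj₁ exposed , ¬same ∘ sameEdge-sym) ◅ Star.map F⊆G-ab yb

    -- A vertex near both `a` and `b`, joined to the one on the opposite side, gives a crossing edge
    -- near `ab`. This carries simpliciality of `ab` among crossing edges over to vertices.
    crossingAt : ∀ {u} → Near G a u → Near G b u →
      ∃ λ f → f ∈ cut × EdgeNear G (a , b) f × (u ≡ proj₁ f ⊎ u ≡ proj₂ f)
    crossingAt {u} au bu with cover u
    ... | inj₁ xu = (u , b) , cut⁺ (xu , yb , near⇒adj G (separated-≢ xu yb) (near-sym G bu)) ,
                    ((au , inj₂ ab) , (bu , near-refl G)) , inj₁ refl
    ... | inj₂ yu = (a , u) , cut⁺ (xa , yu , near⇒adj G (separated-≢ xa yu) au) ,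
                    ((near-refl G , au) , (inj₂ (Graph.symm G ab) , bu)) , inj₂ refl

    near : CliqueNeighbourhood G a b
    near au bu av bv with crossingAt au bu | crossingAt av bv
    ... | f , f∈ , ef , u∈f | g , g∈ , eg , v∈g with simplicial f∈ g∈ ef eg | u∈f | v∈g
    ... | (uv , _) , _ | inj₁ refl | inj₁ refl = uv
    ... | (_ , uv) , _ | inj₁ refl | inj₂ refl = uv
    ... | _ , (uv , _) | inj₂ refl | inj₁ refl = uv
    ... | _ , (_ , uv) | inj₂ refl | inj₂ refl = uv

-- Trees

record SimplePath (R : Rel (Fin n) 0ℓ) (x y : Fin n) : Set where
  field
    k         : ℕ
    v         : Fin (suc k) → Fin n
    injective : Injective _≡_ _≡_ v
    step      : (i : Fin k) → R (v (inject₁ i)) (v (suc i))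
    start     : v zero ≡ x
    end       : v (fromℕ k) ≡ y

module _ {R : Rel (Fin n) 0ℓ} where

  suffix : ∀ {x y} (p : SimplePath R x y) i → SimplePath R (SimplePath.v p i) y
  suffix p zero = record { SimplePath p hiding (start) ; start = refl }
  suffix record { k = suc k ; v = v ; injective = inj ; step = step ; end = end } (suc i) =
    suffix (record { k = k ; v = v ∘ suc ; injective = suc-injective ∘ inj ; step = step ∘ suc
                   ; start = refl ; end = end }) i

  -- Loop erasure: if the new first vertex already occurs on the path, only the part from there on
  -- is kept.
  simplePath : ∀ {x y} → Star R x y → SimplePath R x y
  simplePath {x} ε = record
    { k = 0 ; v = λ _ → x ; injective = λ { {zero} {zero} _ → refl } ; step = λ () ; start = refl ; end = refl }
  simplePath {x} {y} (_◅_ {j = z} xz walk) with simplePath walk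
  ... | p with any? (λ i → SimplePath.v p i ≟ x)
  ... | yes (i , vi≡x) = subst (λ w → SimplePath R w y) vi≡x (suffix p i)
  ... | no x∉p = record
      { k = suc k ; v = v′ ; injective = injective′ ; step = step′ ; start = refl ; end = end }
    where
    open SimplePath p
    v′ : Fin (suc (suc k)) → Fin _
    v′ zero    = x
    v′ (suc i) = v i
    injective′ : Injective _≡_ _≡_ v′
    injective′ {zero}  {zero}  _  = refl
    injective′ {zero}  {suc j} eq = contradiction (j , sym eq) x∉p
    injective′ {suc i} {zero}  eq = contradiction (i , eq) x∉p
    injective′ {suc i} {suc j} eq = cong suc (injective eq)
    step′ : (i : Fin (suc k)) → R (v′ (inject₁ i)) (v′ (suc i))
    step′ zero    = subst (R x) (sym start) xz
    step′ (suc i) = step i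

  star-steps : ∀ k (v : Fin (suc k) → Fin n) → ((i : Fin k) → R (v (inject₁ i)) (v (suc i))) →
    Star R (v zero) (v (fromℕ k))
  star-steps ℕ.zero  v step = ε
  star-steps (suc k) v step = step zero ◅ star-steps k (v ∘ suc) (step ∘ suc)

-- Acyclicity in terms of walks, which is decidable by `connected?` and easy to check after an
-- exchange.
EveryEdgeBridge : Graph n → Set
EveryEdgeBridge T = ∀ x y → Adj T x y → ¬ Star (Adj (deleteEdge T x y)) x y

-- A simple path that avoids `xy` has length at least two, and `xy` closes it to a cycle.
acyclic⇒bridges : ∀ {T : Graph n} → ¬ Cycle T → EveryEdgeBridge T
acyclic⇒bridges {T = T} acyclic x y xy walk with simplePath walk
... | record { k = 0 ; start = refl ; end = end } = adj⇒≢ T xy end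
... | record { k = 1 ; step = step ; start = refl ; end = refl } = proj₂ (step zero) (inj₁ (refl , refl))
... | record { k = suc (suc k) ; v = v ; injective = inj ; step = step ; start = refl ; end = refl } =
  acyclic record { k = k ; v = v ; injective = inj ; step = proj₁ ∘ step ; close = Graph.symm T xy }

bridges⇒acyclic : ∀ {T : Graph n} → EveryEdgeBridge T → ¬ Cycle T
bridges⇒acyclic {T = T} bridges record { k = k ; v = v ; injective = inj ; step = step ; close = close } =
  bridges _ _ (Graph.symm T close) (star-steps (2 ℕ.+ k) v λ i → step i , ¬closing i)
  where
  ¬closing : ∀ i → ¬ SameEdge (v (inject₁ i)) (v (suc i)) (v zero) (v (fromℕ (2 ℕ.+ k)))
  -- The first step differs from the closing edge because a cycle has at least three vertices.
  ¬closing zero    (inj₁ (_ , eq)) with () ← inj eq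
  ¬closing (suc i) (inj₁ (eq , _)) with () ← inj eq
  ¬closing i       (inj₂ (eq , _)) = fromℕ≢inject₁ (sym (inj eq))

deleteEdge-mono : ∀ {G H : Graph n} {x y} → G ⊆ᴳ H → deleteEdge G x y ⊆ᴳ deleteEdge H x y
deleteEdge-mono G⊆H (ab , ¬same) = G⊆H ab , ¬same

isTree? : ∀ (G : Graph n) → Dec (IsTree G)
isTree? G = map′ (λ (conn , bridges) → conn , bridges⇒acyclic bridges)
                 (λ (conn , acyclic) → conn , acyclic⇒bridges {T = G} acyclic)
  (all? (λ x → all? (λ y → connected? G x y)) ×-dec
   all? (λ x → all? (λ y → adj? G x y →-dec ¬? (connected? (deleteEdge G x y) x y))))

tree-resp-≈ᴳ : ∀ {G H : Graph n} → G ≈ᴳ H → IsTree G → IsTree H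
tree-resp-≈ᴳ {G = G} {H} G≈H (conn , acyclic) =
  (λ x y → Star.map (Equivalence.to (G≈H _ _)) (conn x y)) ,
  λ cycle → acyclic record
    { Cycle cycle hiding (step; close)
    ; step  = Equivalence.from (G≈H _ _) ∘ Cycle.step cycle
    ; close = Equivalence.from (G≈H _ _) (Cycle.close cycle) }

insertEdge : Graph n → (a b : Fin n) → a ≢ b → Graph n
insertEdge G a b a≢b = record
  { Adj    = λ u v → Adj G u v ⊎ SameEdge u v a b
  ; adj?   = λ u v → adj? G u v ⊎-dec SameEdge? u v a b
  ; symm   = Sum.map (Graph.symm G) λ { (inj₁ (p , q)) → inj₂ (q , p) ; (inj₂ (p , q)) → inj₁ (q , p) }
  ; irrefl = λ where
      u≡v (inj₁ uv)                   → Graph.irrefl G u≡v uv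
      refl (inj₂ (inj₁ (refl , u≡b))) → a≢b u≡b
      refl (inj₂ (inj₂ (refl , u≡a))) → a≢b (sym u≡a)
  }

deleteEdge-cover : ∀ (G : Graph n) x y {u v} → Adj G u v → Adj (deleteEdge G x y) u v ⊎ SameEdge u v x y
deleteEdge-cover G x y {u} {v} uv with SameEdge? u v x y
... | yes same  = inj₂ same
... | no  ¬same = inj₁ (uv , ¬same)

-- The ends `a` and `b` lie in the two components left by `xy`, so walks can use `ab` in place of
-- `xy`, and nothing else joins these components.
exchange-tree : ∀ {T : Graph n} {x y a b} → IsTree T → Adj T x y → (a≢b : a ≢ b) →
  Star (Adj (deleteEdge T x y)) x a → Star (Adj (deleteEdge T x y)) y b →
  IsTree (insertEdge (deleteEdge T x y) a b a≢b)
exchange-tree {T = T} {x} {y} {a} {b} (conn , acyclic) xy a≢b xa yb =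
  (λ u v → kleisli (conn u v)) , bridges⇒acyclic bridge
  where
  F : Graph _
  F = deleteEdge T x y
  T′ : Graph _
  T′ = insertEdge F a b a≢b

  reconnect : Star (Adj T′) x y
  reconnect = Star.map inj₁ xa ◅◅ inj₂ (inj₁ (refl , refl)) ◅ Star.map inj₁ (connected-sym F yb)

  kleisli : ∀ {u v} → Star (Adj T) u v → Star (Adj T′) u v
  kleisli = Star.kleisliStar id λ uv → case deleteEdge-cover T x y uv of λ where
    (inj₁ uv∈F)                 → inj₁ uv∈F ◅ ε
    (inj₂ (inj₁ (refl , refl))) → reconnect
    (inj₂ (inj₂ (refl , refl))) → connected-sym T′ reconnect

  separated : ¬ Star (Adj F) a b
  separated ab = acyclic⇒bridges acyclic x y xy (xa ◅◅ ab ◅◅ connected-sym F yb)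

  bridge : EveryEdgeBridge T′
  bridge p q (inj₂ same) walk = separated (orient same (Star.map (λ where
      (inj₁ uv , _)       → uv
      (inj₂ uv-ab , ¬pq)  → contradiction (sameEdge-trans uv-ab (sameEdge-sym same)) ¬pq) walk))
    where
    orient : SameEdge p q a b → Star (Adj F) p q → Star (Adj F) a b
    orient (inj₁ (refl , refl)) pq = pq
    orient (inj₂ (refl , refl)) pq = connected-sym F pq
  bridge p q (inj₁ pq) walk with star-insert (λ where
      (inj₁ uv , ¬pq)  → inj₁ (uv , ¬pq)
      (inj₂ same , _)  → inj₂ same) walk
  ... | inj₁ pq′ = acyclic⇒bridges acyclic p q (proj₁ pq) (Star.map (deleteEdge-mono {G = F} {T} proj₁) pq′)
  -- A detour around the old edge `pq` that uses `ab` would, together with `pq`, join `a` to `b`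
  -- inside `F`.
  ... | inj₂ (inj₁ (pa , bq)) = separated
    (connected-sym F (Star.map proj₁ pa) ◅◅ pq ◅ connected-sym F (Star.map proj₁ bq))
  ... | inj₂ (inj₂ (pb , aq)) = separated
    (Star.map proj₁ aq ◅◅ Graph.symm F pq ◅ Star.map proj₁ pb)

-- Enumerating spanning trees

-- Up to `≈ᴳ` every graph comes from a sublist of `allPairs n`, so a lightest tree can be sought
-- among finitely many lists.
ofPairs : List (Fin n × Fin n) → Graph n
ofPairs L = record
  { Adj    = λ u v → u ≢ v × Listed L u v
  ; adj?   = λ u v → ¬? (u ≟ v) ×-dec Any.any? (λ (a , b) → SameEdge? u v a b) L
  ; symm   = λ (u≢v , uv) → u≢v ∘ sym , Any.map Sum.swap (Any.map (Sum.map swap swap) uv)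
  ; irrefl = λ u≡v (u≢v , _) → u≢v u≡v
  }

≈ᴳ-ofPairs : ∀ (G : Graph n) → G ≈ᴳ ofPairs (adjPairs G)
≈ᴳ-ofPairs G u v = mk⇔ (λ uv → adj⇒≢ G uv , listed⁺ G uv) (listed⁻ G ∘ proj₂)

sublists : ∀ {A : Set} → List A → List (List A)
sublists []       = [] ∷ []
sublists (x ∷ xs) = map (x ∷_) (sublists xs) ++ sublists xs

filter∈sublists : ∀ {A : Set} {P : Pred A 0ℓ} (P? : Decidable₁ P) xs → filter P? xs ∈ sublists xs
filter∈sublists P? []       = here refl
filter∈sublists P? (x ∷ xs) with does (P? x)
... | true  = ∈-++⁺ˡ (∈-map⁺ (x ∷_) (filter∈sublists P? xs))
... | false = ∈-++⁺ʳ (map (x ∷_) (sublists xs)) (filter∈sublists P? xs)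

starGraph : Fin n → Graph n
starGraph c = record
  { Adj    = λ u v → u ≢ v × (u ≡ c ⊎ v ≡ c)
  ; adj?   = λ u v → ¬? (u ≟ v) ×-dec ((u ≟ c) ⊎-dec (v ≟ c))
  ; symm   = λ (u≢v , centre) → u≢v ∘ sym , Sum.swap centre
  ; irrefl = λ u≡v (u≢v , _) → u≢v u≡v
  }

starGraph-tree : ∀ (c : Fin n) → IsTree (starGraph c)
starGraph-tree c = (λ u v → toCentre u ◅◅ connected-sym S (toCentre v)) , bridges⇒acyclic bridge
  where
  S : Graph _
  S = starGraph c
  toCentre : ∀ u → Star (Adj S) u c
  toCentre u with u ≟ c
  ... | yes refl = ε
  ... | no  u≢c  = (u≢c , inj₂ refl) ◅ ε
  bridge : EveryEdgeBridge S
  -- The only edge at the leaf is deleted, so no walk leaves the leaf; if the leaf comes second, the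
  -- walk is reversed to start there.
  bridge x y (x≢y , inj₁ refl) walk with connected-sym (deleteEdge S x y) walk
  ... | ε = x≢y refl
  ... | ((_ , inj₁ y≡x) , _) ◅ _ = x≢y (sym y≡x)
  ... | ((_ , inj₂ refl) , ¬same) ◅ _ = ¬same (inj₂ (refl , refl))
  bridge x y (x≢y , inj₂ refl) ε = x≢y refl
  bridge x y (x≢y , inj₂ refl) (((_ , inj₁ x≡y) , _) ◅ _) = x≢y x≡y
  bridge x y (x≢y , inj₂ refl) (((_ , inj₂ refl) , ¬same) ◅ _) = ¬same (inj₁ (refl , refl))

someTree : ∀ n → ∃ λ (T : Graph n) → IsTree T
someTree ℕ.zero  = complete 0 , (λ ()) , λ cycle → ¬Fin0 (Cycle.v cycle zero)
someTree (suc n) = starGraph zero , starGraph-tree zero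

-- Edge sums and minimum weight

filter-agree : ∀ {A : Set} {P Q : Pred A 0ℓ} (P? : Decidable₁ P) (Q? : Decidable₁ Q) {L} →
  All (λ x → P x ⇔ Q x) L → filter P? L ≡ filter Q? L
filter-agree P? Q? [] = refl
filter-agree P? Q? {x ∷ L} (P⇔Q ∷ rest) with P? x
... | yes px = trans (cong (x ∷_) (filter-agree P? Q? rest)) (sym (filter-accept Q? (Equivalence.to P⇔Q px)))
... | no ¬px = trans (filter-agree P? Q? rest) (sym (filter-reject Q? (¬px ∘ Equivalence.from P⇔Q)))

module _ {c ℓ₁ ℓ₂} (R : OrderedAbelianGroup c ℓ₁ ℓ₂) where
  open OrderedAbelianGroup R
  private
    additiveGroup : AbelianGroup _ _
    additiveGroup = record { isAbelianGroup = isAbelianGroup }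
    module Add = AbelianGroup additiveGroup
    module Ord = IsTotalOrder isTotalOrder
    totalOrder : TotalOrder _ _ _
    totalOrder = record { isTotalOrder = isTotalOrder }
  open import Relation.Binary.Reasoning.Setoid Add.setoid

  sumOf : ∀ {A : Set} → (A → Carrier) → List A → Carrier
  sumOf f L = foldr _+_ 0# (map f L)

  -- By uniqueness `p` occurs once in `L`, and elsewhere the two filters agree.
  sumOf-filter-insert : ∀ {A : Set} (f : A → Carrier) {P Q : Pred A 0ℓ}
    (P? : Decidable₁ P) (Q? : Decidable₁ Q) {p L} → Unique L → p ∈ L → ¬ P p → Q p →
    (∀ {q} → q ≢ p → P q ⇔ Q q) → sumOf f (filter Q? L) ≈ sumOf f (filter P? L) + f p
  sumOf-filter-insert f P? Q? {p} {_ ∷ L} (p∉L ∷ _) (here refl) ¬Pp Qp agree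
    rewrite filter-accept Q? {xs = L} Qp | filter-reject P? {xs = L} ¬Pp
          | filter-agree P? Q? (All.map (λ p≢q → agree (p≢q ∘ sym)) p∉L) = Add.comm _ _
  sumOf-filter-insert f P? Q? {p} {q ∷ L} (q∉L ∷ unique) (there p∈L) ¬Pp Qp agree
    with P? q | agree {q} (All.lookup q∉L p∈L)
       | sumOf-filter-insert f P? Q? unique p∈L ¬Pp Qp agree
  ... | yes Pq | P⇔Q | ih rewrite filter-accept Q? {xs = L} (Equivalence.to P⇔Q Pq) = begin
    f q + sumOf f (filter Q? L)              ≈⟨ Add.∙-congˡ ih ⟩
    f q + (sumOf f (filter P? L) + f p)      ≈⟨ Add.assoc _ _ _ ⟨
    f q + sumOf f (filter P? L) + f p        ∎
  ... | no ¬Pq | P⇔Q | ih rewrite filter-reject Q? {xs = L} (¬Pq ∘ Equivalence.from P⇔Q) = ih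

  module _ {n : ℕ} {d : DistanceFunction (Fin n) Carrier} where

    weight-resp-≈ᴳ : ∀ {G H : Graph n} → G ≈ᴳ H → weight R d G ≡ weight R d H
    weight-resp-≈ᴳ {G} {H} G≈H = cong (sumOf (uncurry d)) (filter-≐ _ _
      ((λ (lt , uv) → lt , Equivalence.to (G≈H _ _) uv) , (λ (lt , uv) → lt , Equivalence.from (G≈H _ _) uv))
      (allPairs n))

    -- As `edges` lists the smaller end first, the new edge contributes the single entry `(a , b)`.
    weight-insert-< : ∀ {G H : Graph n} {a b} → a < b → ¬ Adj G a b →
      (∀ {u v} → Adj H u v ⇔ (Adj G u v ⊎ SameEdge u v a b)) → weight R d H ≈ weight R d G + d a b
    weight-insert-< {G} {H} {a} {b} a<b ab∉G H⇔ = sumOf-filter-insert (uncurry d) _ _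
      (Unique.cartesianProduct⁺ (Unique.allFin⁺ n) (Unique.allFin⁺ n)) (∈-allPairs (a , b))
      (ab∉G ∘ proj₂) (a<b , Equivalence.from H⇔ (inj₂ (inj₁ (refl , refl))))
      λ {q} q≢ab → mk⇔ (λ (lt , uv) → lt , Equivalence.from H⇔ (inj₁ uv))
                       (λ (lt , uv) → lt , old q≢ab lt (Equivalence.to H⇔ uv))
      where
      old : ∀ {u v} → (u , v) ≢ (a , b) → u < v → Adj G u v ⊎ SameEdge u v a b → Adj G u v
      old _ _  (inj₁ uv)                       = uv
      old ≢ab _  (inj₂ (inj₁ (refl , refl))) = contradiction refl ≢ab
      old _ b<a (inj₂ (inj₂ (refl , refl)))  = contradiction b<a (<-asym a<b)

    weight-insert : (∀ x y → d x y ≈ d y x) → ∀ {G H : Graph n} {a b} → a ≢ b → ¬ Adj G a b →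
      (∀ {u v} → Adj H u v ⇔ (Adj G u v ⊎ SameEdge u v a b)) → weight R d H ≈ weight R d G + d a b
    weight-insert d-sym {G} {H} {a} {b} a≢b ab∉G H⇔ with <-cmp a b
    ... | tri< a<b _ _ = weight-insert-< {G} {H} a<b ab∉G H⇔
    ... | tri≈ _ a≡b _ = contradiction a≡b a≢b
    -- The listed entry is now `(b , a)`, and symmetry of `d` restores `d a b`.
    ... | tri> _ _ b<a = Add.trans
      (weight-insert-< {G} {H} b<a (ab∉G ∘ Graph.symm G)
        (mk⇔ (Sum.map₂ Sum.swap ∘ Equivalence.to H⇔) (Equivalence.from H⇔ ∘ Sum.map₂ Sum.swap)))
      (Add.∙-congˡ (d-sym b a))

    minimumSpanningTree : ∃ λ T → IsMinimumSpanningTree R d T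
    minimumSpanningTree = T , (adj⇒≢ T , T-tree) , minimal
      where
      open Extrema totalOrder
      isTreeList? : ∀ L → Dec (IsTree (ofPairs L))
      isTreeList? L = isTree? (ofPairs L)
      candidates : List (List (Fin n × Fin n))
      candidates = filter isTreeList? (sublists (allPairs n))
      -- The starting value of `argmin` encodes a tree itself, so `best` does in every case.
      default : List (Fin n × Fin n)
      default = adjPairs (proj₁ (someTree n))
      best : List (Fin n × Fin n)
      best = argmin (weight R d ∘ ofPairs) default candidates
      T : Graph n
      T = ofPairs best
      T-tree : IsTree T
      T-tree = argmin-all (weight R d ∘ ofPairs) {P = λ L → IsTree (ofPairs L)}
        (tree-resp-≈ᴳ (≈ᴳ-ofPairs (proj₁ (someTree n))) (proj₂ (someTree n)))
        (All.tabulate λ L∈ → proj₂ (∈-filter⁻ isTreeList? {xs = sublists (allPairs n)} L∈))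
      minimal : ∀ T′ → IsSpanningTree (complete n) T′ → weight R d T ≤ weight R d T′
      minimal T′ (_ , tree) = subst (weight R d T ≤_) (sym (weight-resp-≈ᴳ {T′} {ofPairs (adjPairs T′)} (≈ᴳ-ofPairs T′)))
        (All.lookup (f[argmin]≤f[xs] {f = weight R d ∘ ofPairs} default candidates)
          (∈-filter⁺ isTreeList? (filter∈sublists _ (allPairs n)) (tree-resp-≈ᴳ (≈ᴳ-ofPairs T′) tree)))

    -- Preservation under erasures

    Invariant : Graph n → Set _
    Invariant G = Chordal (Near G) × (∃ λ T → T ⊆ᴳ G × IsMinimumSpanningTree R d T)

    -- Both trees are `T` without `xy` plus one edge, so comparing their weights comes down to
    -- `d a b ≤ d x y`.
    exchange-minimum : (∀ x y → d x y ≈ d y x) → ∀ {T : Graph n} {x y a b} →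
      IsMinimumSpanningTree R d T → Adj T x y → (a≢b : a ≢ b) → d a b ≤ d x y →
      Star (Adj (deleteEdge T x y)) x a → Star (Adj (deleteEdge T x y)) y b →
      IsMinimumSpanningTree R d (insertEdge (deleteEdge T x y) a b a≢b)
    exchange-minimum d-sym {T} {x} {y} {a} {b} ((_ , tree) , minimal) xy a≢b ab≤xy xa yb =
      (adj⇒≢ T′ , exchange-tree {T = T} tree xy a≢b xa yb) ,
      λ T″ spanning → Ord.trans T′≤T (minimal T″ spanning)
      where
      F T′ : Graph n
      F  = deleteEdge T x y
      T′ = insertEdge F a b a≢b
      ab∉F : ¬ Adj F a b
      ab∉F ab = acyclic⇒bridges (proj₂ tree) x y xy (xa ◅◅ ab ◅ connected-sym F yb)
      T≈F+xy : weight R d T ≈ weight R d F + d x y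
      T≈F+xy = weight-insert d-sym {F} {T} (adj⇒≢ T xy) (λ (_ , ¬same) → ¬same (inj₁ (refl , refl)))
        (mk⇔ (deleteEdge-cover T x y) λ where
          (inj₁ (uv , _))             → uv
          (inj₂ (inj₁ (refl , refl))) → xy
          (inj₂ (inj₂ (refl , refl))) → Graph.symm T xy)
      T′≈F+ab : weight R d T′ ≈ weight R d F + d a b
      T′≈F+ab = weight-insert d-sym {F} {T′} a≢b ab∉F (mk⇔ id id)
      T′≤T : weight R d T′ ≤ weight R d T
      T′≤T = Ord.≤-respˡ-≈ (Add.sym (Add.trans T′≈F+ab (Add.comm _ _)))
        (Ord.≤-respʳ-≈ (Add.sym (Add.trans T≈F+xy (Add.comm _ _))) (+-monoˡ-≤ _ ab≤xy))

    erasure-invariant : (∀ x y → d x y ≈ d y x) → ∀ {G H : Graph n} → IsErasure R d G H →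
      Invariant G → Invariant H
    erasure-invariant d-sym {G} {H} (x , y , exposed , heaviest , H≈) (chordal , T , T⊆G , minimum) =
      chordal-deleteEdge {G = G} {H} chordal (exposed⇒cliqueNeighbourhood G exposed) H≈ , tree
      where
      F : Graph n
      F = deleteEdge T x y
      ⊆H : ∀ {u v} → Adj G u v → ¬ SameEdge u v x y → Adj H u v
      ⊆H uv ¬same = Equivalence.from (H≈ _ _) (uv , ¬same)

      tree : ∃ λ T → T ⊆ᴳ H × IsMinimumSpanningTree R d T
      tree with adj? T x y
      ... | no xy∉T = T , (λ uv → ⊆H (T⊆G uv) λ where
              (inj₁ (refl , refl)) → xy∉T uv
              (inj₂ (refl , refl)) → xy∉T (Graph.symm T uv)) , minimum
      ... | yes xy = replace (anotherExposed {G = G} {F} chordal (T⊆G ∘ proj₁) exposed x≁y cover)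
        where
        x≁y : ¬ Star (Adj F) x y
        x≁y = acyclic⇒bridges (proj₂ (proj₂ (proj₁ minimum))) x y xy
        -- A walk of `T` from `x` to `v`, cut at its use of `xy`, shows on which side `v` lies.
        cover : ∀ v → Star (Adj F) x v ⊎ Star (Adj F) y v
        cover v with star-insert (deleteEdge-cover T x y) (proj₁ (proj₂ (proj₁ minimum)) x v)
        ... | inj₁ xv             = inj₁ xv
        ... | inj₂ (inj₁ (_ , yv)) = inj₂ yv
        ... | inj₂ (inj₂ (_ , xv)) = inj₁ xv
        replace : (∃₂ λ a b → Star (Adj F) x a × Star (Adj F) y b × IsExposed G a b × ¬ SameEdge a b x y) →
          ∃ λ T → T ⊆ᴳ H × IsMinimumSpanningTree R d T
        replace (a , b , xa , yb , ab-exposed , ¬same) =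
          insertEdge F a b a≢b , ⊆H′ ,
          exchange-minimum d-sym {T} minimum xy a≢b (heaviest a b ab-exposed) xa yb
          where
          ab : Adj G a b
          ab = proj₁ ab-exposed
          a≢b : a ≢ b
          a≢b = adj⇒≢ G ab
          ⊆H′ : insertEdge F a b a≢b ⊆ᴳ H
          ⊆H′ (inj₁ (uv , uv≢xy))         = ⊆H (T⊆G uv) uv≢xy
          ⊆H′ (inj₂ (inj₁ (refl , refl))) = ⊆H ab ¬same
          ⊆H′ (inj₂ (inj₂ (refl , refl))) = Graph.symm H (⊆H ab ¬same)

theorem3p2 : ∀ {c ℓ₁ ℓ₂ : Level} (R : OrderedAbelianGroup c ℓ₁ ℓ₂)
    (n : ℕ) (d : DistanceFunction (Fin n) (OrderedAbelianGroup.Carrier R)) → IsMetric R d →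
    (m : ℕ) (G : Fin (suc m) → Graph n) →
    G zero ≈ᴳ complete n →
    ((i : Fin m) → IsErasure R d (G (inject₁ i)) (G (suc i))) →
    ∃ λ (T : Graph n) → T ⊆ᴳ G (fromℕ m) × IsMinimumSpanningTree R d T
theorem3p2 R n d metric m G G₀-complete erasures = proj₂
  (<-weakInduction (λ i → Invariant R {d = d} (G i)) (chordal₀ , tree₀)
    (λ i → erasure-invariant R {d = d} (IsGeneralMetric.sym metric) {G (inject₁ i)} {G (suc i)} (erasures i)) (fromℕ m))
  where
  chordal₀ : Chordal (Near (G zero))
  -- In the complete graph every vertex is simplicial.
  chordal₀ L _ {v} v∈L = v , v∈L , λ {a} {b} _ _ _ _ → near₀ a b
    where
    near₀ : ∀ a b → Near (G zero) a b
    near₀ a b with a ≟ b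
    ... | yes a≡b = inj₁ a≡b
    ... | no  a≢b = inj₂ (Equivalence.from (G₀-complete a b) a≢b)
  tree₀ : ∃ λ T → T ⊆ᴳ G zero × IsMinimumSpanningTree R d T
  tree₀ with minimumSpanningTree R {d = d}
  ... | T , minimum = T , (λ uv → Equivalence.from (G₀-complete _ _) (proj₁ (proj₁ minimum) uv)) , minimum
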